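{- For all $n \geq 8$, \[\text{ex}(n,H_1) = {n+1 \choose 2} - 3.\]
   Context: A $(2\to 1)$-graph (directed hypergraph) is a pair $H=(V,E)$ with $V$ a finite set and $E$ a set of pointed $3$-subsets of $V$: an edge, written $ab\to c$ (same as $ba\to c$), consists of three distinct vertices with head $c$ and tail set $\{a,b\}$. A $3$-subset of $V$ may carry up to three edges. $H$ is $F$-free if there is no injective map $\phi:V(F)\to V(H)$ such that $ab\to c\in E(F)$ implies $\phi(a)\phi(b)\to\phi(c)\in E(H)$. $\text{ex}(n,F)$ is the maximum number of edges of an $F$-free $(2\to1)$-graph on $n$ vertices. $H_1$ is the $(2\to1)$-graph with vertex set $\{a,b,c,d,x\}$ (five distinct vertices) and edges $ax\to b$, $cx\to d$. -}

module Defs where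

open import Data.Bool using (Bool; true; false; T)
open import Data.Bool.Properties using (T?) renaming (_≟_ to _≟ᵇ_)
open import Data.Fin using (Fin)
open import Data.Fin.Patterns using (0F; 1F; 2F; 3F; 4F)
open import Data.Fin.Properties using (_≟_; _<?_; all?)
open import Data.List using (List; allFin; cartesianProduct; filter; length)
open import Data.Nat using (ℕ; _≤_)
open import Data.Product using (_×_; _,_; ∃-syntax)
open import Function.Definitions using (Injective)
open import Relation.Binary.PropositionalEquality using (_≡_; _≢_)
open import Relation.Nullary using (¬_)
open import Relation.Nullary.Decidable using (toWitness; ¬?; _×-dec_; _→-dec_)

-- A (2→1)-graph on n vertices. The edge set is given by its indicator
-- function: edge a b c ≡ true means that ab→c (tail set {a,b}, head c) is an
-- edge. A single edge is thus represented by both triples (a , b , c) and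
-- (b , a , c).
record Graph (n : ℕ) : Set where
  field
    edge      : Fin n → Fin n → Fin n → Bool
    symmetric : ∀ a b c → edge a b c ≡ edge b a c
    distinct  : ∀ a b c → T (edge a b c) → a ≢ b × a ≢ c × b ≢ c

open Graph public

-- Each edge is listed once, with its tail set {a,b} ordered so that a < b.
edges : ∀ {n} → Graph n → List (Fin n × Fin n × Fin n)
edges {n} H =
  filter (λ { (a , b , c) → (a <? b) ×-dec T? (edge H a b c) })
         (cartesianProduct (allFin n) (cartesianProduct (allFin n) (allFin n)))

edgeCount : ∀ {n} → Graph n → ℕ
edgeCount H = length (edges H)

_IsFreeOf_ : ∀ {n k} → Graph n → Graph k → Set
_IsFreeOf_ {n} {k} H F =
  ¬ (∃[ φ ] Injective {A = Fin k} {B = Fin n} _≡_ _≡_ φ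
          × (∀ a b c → T (edge F a b c) → T (edge H (φ a) (φ b) (φ c))))

-- ex(n,F) = m. The maximum is a relation, not a function, because it does not
-- exist when no graph on n vertices is F-free (e.g. F edgeless on at most n
-- vertices).
ex[_,_]≡_ : ∀ {k} → ℕ → Graph k → ℕ → Set
ex[ n , F ]≡ m =
    (∃[ H ] H IsFreeOf F × edgeCount {n} H ≡ m)
  × (∀ (H : Graph n) → H IsFreeOf F → edgeCount H ≤ m)

-- The vertices a, b, c, d, x are 0, 1, 2, 3, 4.
H₁-edge : Fin 5 → Fin 5 → Fin 5 → Bool
H₁-edge 0F 4F 1F = true   -- ax→b
H₁-edge 4F 0F 1F = true
H₁-edge 2F 4F 3F = true   -- cx→d
H₁-edge 4F 2F 3F = true
H₁-edge _  _  _  = false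

H₁ : Graph 5
H₁ = record
  { edge      = H₁-edge
  ; symmetric = toWitness
      {a? = all? λ a → all? λ b → all? λ c → H₁-edge a b c ≟ᵇ H₁-edge b a c} _
  ; distinct  = toWitness
      {a? = all? λ a → all? λ b → all? λ c →
        T? (H₁-edge a b c) →-dec (¬? (a ≟ b) ×-dec ¬? (a ≟ c) ×-dec ¬? (b ≟ c))} _
  }

{-# OPTIONS --safe #-}
module Submission where

-- For a vertex a let its link be the digraph of arcs b→c with ab→c an edge. H is H₁-free iff any
-- two arcs of each link meet, so that every link is a star or lives on three vertices. Twice the
-- number of edges is the sum of the link sizes. Call a pair {x,y} heavy if it is the tail set of
-- at least three edges: then the links of x and y are stars centred at y and x, and the heavy
-- pairs form a matching. Discharge: every edge xa→y with {x,y} heavy moves one unit from x to a.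
-- Afterwards each vertex has charge at most n + 1, and the vertices of heavy pairs have at most
-- n − 2. As heavy vertices come in pairs, the total is at most n(n + 1) − 6; if there is no heavy
-- pair, every link has size at most n and the total is at most n² ≤ n(n + 1) − 6.
-- Equality holds for the edges ab→0 (a, b ≠ 0), 01→c and 0b→1.

open import Defs
open import Data.Nat using (ℕ; suc; _≤_; _∸_)
open import Data.Nat.Combinatorics using (_C_)

open import Data.Bool using (Bool; true; false; T; _∧_; not)
open import Data.Bool.Properties using (T?; T-∧)
open import Data.Empty using (⊥-elim)
open import Data.Fin using (Fin; zero; suc)
open import Data.Fin.Patterns using (0F; 1F; 2F; 3F; 4F)
open import Data.Fin.Properties using (_≟_; _<?_; <-cmp; all?; any?)
open import Data.List using ([]; _∷_; _++_; allFin; cartesianProduct; filter; length; map; tabulate)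
open import Data.List.Properties using (filter-++; length-++)
open import Data.Nat using (zero; z≤n; s≤s; _+_; _*_; _≤ᵇ_; _≤?_)
open import Data.Nat.Combinatorics using (nC1≡n; nCk+nC[k+1]≡[n+1]C[k+1])
open import Data.Nat.Properties hiding (_≟_; _<?_; <-cmp)
open import Data.Nat.Tactic.RingSolver using (solve-∀)
open import Data.Product using (_×_; _,_; ∃; ∃-syntax; proj₁; proj₂)
open import Data.Sum using (_⊎_; inj₁; inj₂; [_,_]; swap)
open import Data.Unit using (tt)
open import Data.Vec using (Vec; []; _∷_; lookup)
open import Data.Vec.Relation.Unary.All using ([]; _∷_)
open import Data.Vec.Relation.Unary.Unique.Propositional using (Unique)
open import Data.Vec.Relation.Unary.AllPairs using ([]; _∷_)
open import Data.Vec.Relation.Unary.Unique.Propositional.Properties using (lookup-injective)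
open import Function using (_∘_; id; Equivalence)
open import Relation.Binary using (tri<; tri≈; tri>)
open import Relation.Binary.PropositionalEquality
  using (_≡_; _≢_; refl; sym; trans; cong; cong₂; subst; ≢-sym; module ≡-Reasoning)
open import Relation.Nullary using (¬_; Dec; yes; no; does; contradiction)
open import Relation.Nullary.Decidable using (toWitness; dec-true; dec-false; ¬?; _×-dec_; _⊎-dec_; _→-dec_)
open import Level using (0ℓ)
open import Relation.Unary using (Pred; Decidable)
open import Algebra.Properties.Semiring.Sum +-*-semiring
  using (sum; sum-cong-≗; ∑-distrib-+; ∑-comm; *-distribˡ-sum)

-- Finite sums and indicator functions.

sum-mono : ∀ {n} {f g : Fin n → ℕ} → (∀ i → f i ≤ g i) → sum f ≤ sum g
sum-mono {zero}  f≤g = z≤n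
sum-mono {suc n} f≤g = +-mono-≤ (f≤g zero) (sum-mono (f≤g ∘ suc))

sum-const : ∀ n k → sum {n} (λ _ → k) ≡ n * k
sum-const zero    k = refl
sum-const (suc n) k = cong (k +_) (sum-const n k)

sum-bounded : ∀ {n} (f : Fin n → ℕ) k → (∀ i → f i ≤ k) → sum f ≤ n * k
sum-bounded {n} f k f≤k = ≤-trans (sum-mono f≤k) (≤-reflexive (sum-const n k))

sum-zero : ∀ {n} (f : Fin n → ℕ) → (∀ i → f i ≤ 0) → sum f ≤ 0
sum-zero {n} f f≤0 = ≤-trans (sum-bounded f 0 f≤0) (≤-reflexive (*-zeroʳ n))

term≤sum : ∀ {n} (f : Fin n → ℕ) i → f i ≤ sum f
term≤sum f zero    = m≤m+n _ _
term≤sum f (suc i) = ≤-trans (term≤sum (f ∘ suc) i) (m≤n+m _ (f zero))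

ι : Bool → ℕ
ι true  = 1
ι false = 0

ι-≤ : ∀ b {k} → (T b → 1 ≤ k) → ι b ≤ k
ι-≤ true  h = h tt
ι-≤ false h = z≤n

1≤ι : ∀ {b} → T b → 1 ≤ ι b
1≤ι {true} _ = ≤-refl

δ : ∀ {n} → Fin n → Fin n → ℕ
δ i j = ι (does (i ≟ j))

1≤δ : ∀ {n} {i j : Fin n} → i ≡ j → 1 ≤ δ i j
1≤δ {i = i} {j} i≡j = ≤-reflexive (sym (cong ι (dec-true (i ≟ j) i≡j)))

sum-δ-* : ∀ {n} (i : Fin n) (f : Fin n → ℕ) → sum (λ j → δ i j * f j) ≡ f i
sum-δ-* {suc n} zero    f =
  trans (cong (1 * f zero +_) (trans (sum-const n 0) (*-zeroʳ n))) (trans (+-identityʳ _) (*-identityˡ _))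
sum-δ-* {suc n} (suc i) f = sum-δ-* i (f ∘ suc)

sum-δ : ∀ {n} (i : Fin n) → sum (δ i) ≡ 1
sum-δ i = trans (sum-cong-≗ (λ j → sym (*-identityʳ (δ i j)))) (sum-δ-* i (λ _ → 1))

-- Each term is dominated by `δ i j * ι (f i)`, and the sum of these collapses. Having `ι (f i)`
-- rather than 1 on the right lets `star-degree` sum it to an in-degree.
sum-supported : ∀ {n} (f : Fin n → Bool) i → (∀ j → T (f j) → j ≡ i) → sum (ι ∘ f) ≤ ι (f i)
sum-supported f i only-i = ≤-trans (sum-mono bound) (≤-reflexive (sum-δ-* i (λ _ → ι (f i))))
  where
  bound : ∀ j → ι (f j) ≤ δ i j * ι (f i)
  bound j = ι-≤ (f j) λ fj → *-mono-≤ (1≤δ (sym (only-i j fj)))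
                                       (1≤ι (subst (T ∘ f) (only-i j fj) fj))

sum-supported₂ : ∀ {n} (f : Fin n → Bool) i j → (∀ k → T (f k) → k ≡ i ⊎ k ≡ j) → sum (ι ∘ f) ≤ 2
sum-supported₂ f i j only-ij = begin
  sum (ι ∘ f)                 ≤⟨ sum-mono bound ⟩
  sum (λ k → δ i k + δ j k)   ≡⟨ ∑-distrib-+ (δ i) (δ j) ⟩
  sum (δ i) + sum (δ j)       ≡⟨ cong₂ _+_ (sum-δ i) (sum-δ j) ⟩
  2                           ∎
  where
  open ≤-Reasoning
  bound : ∀ k → ι (f k) ≤ δ i k + δ j k
  bound k = ι-≤ (f k) λ fk → [ (λ k≡i → ≤-trans (1≤δ (sym k≡i)) (m≤m+n _ _))
                             , (λ k≡j → ≤-trans (1≤δ (sym k≡j)) (m≤n+m _ _)) ] (only-ij k fk)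

-- Adding `δ i` and `δ j` only fills the two places where `f` fails, so every term stays at most 1.
sum-avoiding₂ : ∀ {n} (f : Fin n → Bool) {i j} → i ≢ j → ¬ T (f i) → ¬ T (f j) →
                sum (ι ∘ f) + 2 ≤ n
sum-avoiding₂ {n} f {i} {j} i≢j ¬fi ¬fj = begin
  sum (ι ∘ f) + 2                             ≡⟨ cong (sum (ι ∘ f) +_) (cong₂ _+_ (sum-δ i) (sum-δ j)) ⟨
  sum (ι ∘ f) + (sum (δ i) + sum (δ j))       ≡⟨ cong (sum (ι ∘ f) +_) (∑-distrib-+ (δ i) (δ j)) ⟨
  sum (ι ∘ f) + sum (λ k → δ i k + δ j k)     ≡⟨ ∑-distrib-+ (ι ∘ f) (λ k → δ i k + δ j k) ⟨
  sum (λ k → ι (f k) + (δ i k + δ j k))       ≤⟨ sum-bounded _ 1 bound ⟩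
  n * 1                                       ≡⟨ *-identityʳ n ⟩
  n                                           ∎
  where
  open ≤-Reasoning
  ι≤1 : ∀ b → ι b ≤ 1
  ι≤1 b = ι-≤ b (λ _ → ≤-refl)
  ι≡0 : ∀ {b} → ¬ T b → ι b ≡ 0
  ι≡0 {true}  ¬b = ⊥-elim (¬b tt)
  ι≡0 {false} ¬b = refl
  bound : ∀ k → ι (f k) + (δ i k + δ j k) ≤ 1
  bound k with i ≟ k | j ≟ k
  ... | yes refl | yes refl = ⊥-elim (i≢j refl)
  ... | yes refl | no _     = ≤-reflexive (cong (_+ 1) (ι≡0 ¬fi))
  ... | no _     | yes refl = ≤-reflexive (cong (_+ 1) (ι≡0 ¬fj))
  ... | no _     | no _     = ≤-trans (≤-reflexive (+-identityʳ _)) (ι≤1 (f k))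

sum-δ-δ : ∀ {m n} (i : Fin m) (j : Fin n) → sum (λ k → sum (λ l → δ i k * δ j l)) ≡ 1
sum-δ-δ {m} {n} i j = trans (sum-cong-≗ {m} λ k → sym (*-distribˡ-sum {n} (δ i k) (δ j)))
                            (trans (sum-δ-* i (λ _ → sum (δ j))) (sum-δ j))

∑∑-distrib-+ : ∀ {m n} (f g : Fin m → Fin n → ℕ) →
  sum (λ i → sum (λ j → f i j + g i j)) ≡ sum (λ i → sum (f i)) + sum (λ i → sum (g i))
∑∑-distrib-+ {m} {n} f g = trans (sum-cong-≗ {m} λ i → ∑-distrib-+ {n} (f i) (g i)) (∑-distrib-+ {m} _ _)

-- Lengths of filtered lists as sums.

length-filter-map : ∀ {A B : Set} {P : Pred B 0ℓ} (P? : Decidable P) (f : A → B) xs →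
                    length (filter P? (map f xs)) ≡ length (filter (P? ∘ f) xs)
length-filter-map P? f []       = refl
length-filter-map P? f (x ∷ xs) with does (P? (f x))
... | true  = cong suc (length-filter-map P? f xs)
... | false = length-filter-map P? f xs

length-filter-tabulate : ∀ {A : Set} {P : Pred A 0ℓ} (P? : Decidable P) {n} (f : Fin n → A) →
                         length (filter P? (tabulate f)) ≡ sum (λ i → ι (does (P? (f i))))
length-filter-tabulate P? {zero}  f = refl
length-filter-tabulate P? {suc n} f with does (P? (f zero))
... | true  = cong suc (length-filter-tabulate P? (f ∘ suc))
... | false = length-filter-tabulate P? (f ∘ suc)

length-filter-product : ∀ {A B : Set} {P : Pred (A × B) 0ℓ} (P? : Decidable P) {n} (f : Fin n → A) ys →
  length (filter P? (cartesianProduct (tabulate f) ys)) ≡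
  sum (λ i → length (filter (λ y → P? (f i , y)) ys))
length-filter-product P? {zero}  f ys = refl
length-filter-product P? {suc n} f ys = begin
  length (filter P? (map (f zero ,_) ys ++ rest))
    ≡⟨ cong length (filter-++ P? (map (f zero ,_) ys) rest) ⟩
  length (filter P? (map (f zero ,_) ys) ++ filter P? rest)
    ≡⟨ length-++ (filter P? (map (f zero ,_) ys)) ⟩
  length (filter P? (map (f zero ,_) ys)) + length (filter P? rest)
    ≡⟨ cong₂ _+_ (length-filter-map P? (f zero ,_) ys) (length-filter-product P? (f ∘ suc) ys) ⟩
  _ ∎
  where
  open ≡-Reasoning
  rest = cartesianProduct (tabulate (f ∘ suc)) ys

length-filter-triples : ∀ {n} {P : Pred (Fin n × Fin n × Fin n) 0ℓ} (P? : Decidable P) →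
  length (filter P? (cartesianProduct (allFin n) (cartesianProduct (allFin n) (allFin n)))) ≡
  sum (λ a → sum (λ b → sum (λ c → ι (does (P? (a , b , c))))))
length-filter-triples {n} P? =
  trans (length-filter-product P? id (cartesianProduct (allFin n) (allFin n)))
        (sum-cong-≗ {n} λ a → trans (length-filter-product (λ p → P? (a , p)) id (allFin n))
          (sum-cong-≗ {n} λ b → length-filter-tabulate (λ c → P? (a , b , c)) id))

-- Double counting: edges and link sizes.

module _ {n} (H : Graph n) where

  tailWeight : Fin n → Fin n → ℕ
  tailWeight a b = sum (λ c → ι (edge H a b c))

  linkDegree : Fin n → ℕ
  linkDegree a = sum (tailWeight a)

  -- The decision procedure of the filter in `edges` computes to this conjunction, so the general
  -- count applies as it stands.
  edgeCount≡sum : edgeCount H ≡ sum (λ a → sum (λ b → sum (λ c → ι (does (a <? b) ∧ edge H a b c))))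
  edgeCount≡sum = length-filter-triples {n} _

  ordered-tails : ∀ a b c → ι (does (a <? b) ∧ edge H a b c) + ι (does (b <? a) ∧ edge H b a c)
                            ≡ ι (edge H a b c)
  ordered-tails a b c with <-cmp a b
  ... | tri< a<b _ b≮a rewrite dec-true (a <? b) a<b | dec-false (b <? a) b≮a = +-identityʳ _
  ... | tri> a≮b _ b<a rewrite dec-false (a <? b) a≮b | dec-true (b <? a) b<a =
    cong ι (symmetric H b a c)
  ... | tri≈ a≮b refl _ rewrite dec-false (a <? a) a≮b with edge H a a c in eq
  ...   | false = refl
  ...   | true  = ⊥-elim (proj₁ (distinct H a a c (subst T (sym eq) tt)) refl)

  -- An edge lies in the links of both its tails. One copy of the count has its tails swapped; by
  -- `ordered-tails` the two copies together run through all ordered tail pairs.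
  2*edgeCount : 2 * edgeCount H ≡ sum linkDegree
  2*edgeCount = begin
    2 * edgeCount H                ≡⟨ cong (edgeCount H +_) (+-identityʳ _) ⟩
    edgeCount H + edgeCount H      ≡⟨ cong₂ _+_ edgeCount≡sum (trans edgeCount≡sum (∑-comm (λ a b → sum (g a b)))) ⟩
    sum (λ a → sum (λ b → sum (g a b))) + sum (λ a → sum (λ b → sum (g b a)))
      ≡⟨ ∑∑-distrib-+ (λ a b → sum (g a b)) (λ a b → sum (g b a)) ⟨
    sum (λ a → sum (λ b → sum (g a b) + sum (g b a)))
      ≡⟨ sum-cong-≗ {n} (λ a → sum-cong-≗ {n} λ b →
           trans (sym (∑-distrib-+ (g a b) (g b a))) (sum-cong-≗ (ordered-tails a b))) ⟩
    sum linkDegree ∎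
    where
    open ≡-Reasoning
    g : Fin n → Fin n → Fin n → ℕ
    g a b c = ι (does (a <? b) ∧ edge H a b c)

2*[1+n]C2 : ∀ n → 2 * (suc n C 2) ≡ suc n * n
2*[1+n]C2 zero    = refl
2*[1+n]C2 (suc n) = begin
  2 * (suc (suc n) C 2)            ≡⟨ cong (2 *_) (nCk+nC[k+1]≡[n+1]C[k+1] (suc n) 1) ⟨
  2 * (suc n C 1 + suc n C 2)      ≡⟨ *-distribˡ-+ 2 (suc n C 1) (suc n C 2) ⟩
  2 * (suc n C 1) + 2 * (suc n C 2) ≡⟨ cong₂ _+_ (cong (2 *_) (nC1≡n (suc n))) (2*[1+n]C2 n) ⟩
  2 * suc n + suc n * n            ≡⟨ lemma n ⟩
  suc (suc n) * suc n              ∎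
  where
  open ≡-Reasoning
  lemma : ∀ n → 2 * suc n + suc n * n ≡ suc (suc n) * suc n
  lemma = solve-∀

-- Pairwise intersecting graphs are stars or triangles.

module _ {n} {L : Fin n → Fin n → Set} (L? : ∀ b c → Dec (L b c))
  (L-sym : ∀ {b c} → L b c → L c b) (L-irrefl : ∀ {b c} → L b c → b ≢ c)
  (meet : ∀ {a b c d} → L a b → L c d → a ≡ c ⊎ a ≡ d ⊎ b ≡ c ⊎ b ≡ d) where

  star-or-avoiding : ∀ s → (∀ {b c} → L b c → b ≡ s ⊎ c ≡ s) ⊎ (∃[ u ] ∃[ v ] L u v × u ≢ s × v ≢ s)
  star-or-avoiding s with any? (λ u → any? λ v → L? u v ×-dec ¬? (u ≟ s) ×-dec ¬? (v ≟ s))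
  ... | yes (u , v , avoiding) = inj₂ (u , v , avoiding)
  ... | no none = inj₁ touching
    where
    touching : ∀ {b c} → L b c → b ≡ s ⊎ c ≡ s
    touching {b} {c} Lbc with b ≟ s | c ≟ s
    ... | yes b≡s | _       = inj₁ b≡s
    ... | no  _   | yes c≡s = inj₂ c≡s
    ... | no  b≢s | no c≢s  = ⊥-elim (none (b , c , Lbc , b≢s , c≢s))

  -- If `b` is off the triangle, then `c` has to lie on all three sides, which have no common
  -- vertex. By symmetry it is enough to speak of `b`.
  triangle : ∀ {p q r} → L p q → L q r → L p r → ∀ {b c} → L b c → b ≡ p ⊎ b ≡ q ⊎ b ≡ r
  triangle pq qr pr bc with meet bc pq | meet bc qr | meet bc pr
  ... | inj₁ b≡p        | _ | _ = inj₁ b≡p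
  ... | inj₂ (inj₁ b≡q) | _ | _ = inj₂ (inj₁ b≡q)
  ... | _ | inj₁ b≡q        | _ = inj₂ (inj₁ b≡q)
  ... | _ | inj₂ (inj₁ b≡r) | _ = inj₂ (inj₂ b≡r)
  ... | _ | _ | inj₁ b≡p        = inj₁ b≡p
  ... | _ | _ | inj₂ (inj₁ b≡r) = inj₂ (inj₂ b≡r)
  ... | inj₂ (inj₂ (inj₁ refl)) | inj₂ (inj₂ (inj₁ c≡q)) | _ = ⊥-elim (L-irrefl pq c≡q)
  ... | inj₂ (inj₂ (inj₁ refl)) | inj₂ (inj₂ (inj₂ c≡r)) | _ = ⊥-elim (L-irrefl pr c≡r)
  ... | inj₂ (inj₂ (inj₂ refl)) | _ | inj₂ (inj₂ (inj₁ c≡p)) = ⊥-elim (L-irrefl pq (sym c≡p))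
  ... | inj₂ (inj₂ (inj₂ refl)) | _ | inj₂ (inj₂ (inj₂ c≡r)) = ⊥-elim (L-irrefl qr c≡r)

  -- The edge `uv` starts at `p` and must meet `qr`; as it avoids `q` and `r ≢ p`, its other end is
  -- `r`.
  closing : ∀ {p q r u v} → L p q → L q r → r ≢ p → L u v → u ≢ q → v ≢ q → p ≡ u → L p r
  closing pq qr r≢p uv u≢q v≢q refl with meet qr uv
  ... | inj₁ q≡p                = ⊥-elim (L-irrefl pq (sym q≡p))
  ... | inj₂ (inj₁ q≡v)         = ⊥-elim (v≢q (sym q≡v))
  ... | inj₂ (inj₂ (inj₁ r≡p))  = ⊥-elim (r≢p r≡p)
  ... | inj₂ (inj₂ (inj₂ refl)) = uv

  -- If `q` is not a centre, an edge avoiding `q` meets `pq` in `p` and closes the path to a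
  -- triangle.
  path : ∀ {p q r} → L p q → L q r → r ≢ p →
         (∃[ s ] ∀ {b c} → L b c → b ≡ s ⊎ c ≡ s) ⊎
         (∃[ p ] ∃[ q ] ∃[ r ] ∀ {b c} → L b c → b ≡ p ⊎ b ≡ q ⊎ b ≡ r)
  path {p} {q} {r} pq qr r≢p with star-or-avoiding q
  ... | inj₁ star = inj₁ (q , star)
  ... | inj₂ (u , v , uv , u≢q , v≢q) with meet pq uv
  ...   | inj₁ p≡u               = inj₂ (p , q , r , triangle pq qr (closing pq qr r≢p uv u≢q v≢q p≡u))
  ...   | inj₂ (inj₁ p≡v)        = inj₂ (p , q , r , triangle pq qr (closing pq qr r≢p (L-sym uv) v≢q u≢q p≡v))
  ...   | inj₂ (inj₂ (inj₁ q≡u)) = ⊥-elim (u≢q (sym q≡u))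
  ...   | inj₂ (inj₂ (inj₂ q≡v)) = ⊥-elim (v≢q (sym q≡v))

  -- If neither `s₀` nor the end `p` of some edge `pq` is a centre, an edge avoiding `p` meets `pq`
  -- in `q`, which gives a path. The given vertex serves as centre when there are no edges.
  star-or-triangle : Fin n →
    (∃[ s ] ∀ {b c} → L b c → b ≡ s ⊎ c ≡ s) ⊎
    (∃[ p ] ∃[ q ] ∃[ r ] ∀ {b c} → L b c → b ≡ p ⊎ b ≡ q ⊎ b ≡ r)
  star-or-triangle s₀ with star-or-avoiding s₀
  ... | inj₁ star = inj₁ (s₀ , star)
  ... | inj₂ (p , q , pq , _) with star-or-avoiding p
  ...   | inj₁ star = inj₁ (p , star)
  ...   | inj₂ (u , v , uv , u≢p , v≢p) with meet pq uv
  ...     | inj₁ p≡u                = ⊥-elim (u≢p (sym p≡u))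
  ...     | inj₂ (inj₁ p≡v)         = ⊥-elim (v≢p (sym p≡v))
  ...     | inj₂ (inj₂ (inj₁ refl)) = path pq uv v≢p
  ...     | inj₂ (inj₂ (inj₂ refl)) = path pq (L-sym uv) u≢p

-- Freeness of `H₁` in terms of links.

H₁-edges : ∀ i j k → T (H₁-edge i j k) →
  (((i ≡ 0F × j ≡ 4F) ⊎ (i ≡ 4F × j ≡ 0F)) × k ≡ 1F) ⊎
  (((i ≡ 2F × j ≡ 4F) ⊎ (i ≡ 4F × j ≡ 2F)) × k ≡ 3F)
H₁-edges = toWitness
  {a? = all? λ i → all? λ j → all? λ k → T? (H₁-edge i j k) →-dec
        ((((i ≟ 0F ×-dec j ≟ 4F) ⊎-dec (i ≟ 4F ×-dec j ≟ 0F)) ×-dec k ≟ 1F) ⊎-dec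
         (((i ≟ 2F ×-dec j ≟ 4F) ⊎-dec (i ≟ 4F ×-dec j ≟ 2F)) ×-dec k ≟ 3F))} _

LinksIntersecting : ∀ {n} → Graph n → Set
LinksIntersecting H = ∀ {x a b c d} → T (edge H x a b) → T (edge H x c d) →
                      a ≡ c ⊎ a ≡ d ⊎ b ≡ c ⊎ b ≡ d

-- Two disjoint arcs in the link of `x`, together with `x`, form a copy of `H₁`.
free⇒intersecting : ∀ {n} (H : Graph n) → H IsFreeOf H₁ → LinksIntersecting H
free⇒intersecting {n} H free {x} {a} {b} {c} {d} xab xcd
  with a ≟ c | a ≟ d | b ≟ c | b ≟ d
... | yes a≡c | _ | _ | _ = inj₁ a≡c
... | _ | yes a≡d | _ | _ = inj₂ (inj₁ a≡d)
... | _ | _ | yes b≡c | _ = inj₂ (inj₂ (inj₁ b≡c))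
... | _ | _ | _ | yes b≡d = inj₂ (inj₂ (inj₂ b≡d))
... | no a≢c | no a≢d | no b≢c | no b≢d =
  ⊥-elim (free (lookup vertices , lookup-injective unique _ _ , embeds))
  where
  vertices : Vec (Fin n) 5
  -- The order is that of the numbering 0 to 4 of the vertices of `H₁`.
  vertices = a ∷ b ∷ c ∷ d ∷ x ∷ []
  unique : Unique vertices
  unique with distinct H x a b xab | distinct H x c d xcd
  ... | x≢a , x≢b , a≢b | x≢c , x≢d , c≢d =
    (a≢b ∷ a≢c ∷ a≢d ∷ ≢-sym x≢a ∷ []) ∷ (b≢c ∷ b≢d ∷ ≢-sym x≢b ∷ []) ∷
    (c≢d ∷ ≢-sym x≢c ∷ []) ∷ (≢-sym x≢d ∷ []) ∷ [] ∷ []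
  embeds : ∀ i j k → T (H₁-edge i j k) →
           T (edge H (lookup vertices i) (lookup vertices j) (lookup vertices k))
  embeds i j k ijk with H₁-edges i j k ijk
  ... | inj₁ (inj₁ (refl , refl) , refl) = subst T (symmetric H x a b) xab
  ... | inj₁ (inj₂ (refl , refl) , refl) = xab
  ... | inj₂ (inj₁ (refl , refl) , refl) = subst T (symmetric H x c d) xcd
  ... | inj₂ (inj₂ (refl , refl) , refl) = xcd

-- Heavy pairs and the sizes of star links.

module UpperBound {n} (H : Graph n) (8≤n : 8 ≤ n) (meet : LinksIntersecting H) where

  Star : Fin n → Fin n → Set
  Star a s = ∀ {b c} → T (edge H a b c) → b ≡ s ⊎ c ≡ s

  w deg : _
  w   = tailWeight H
  deg = linkDegree H

  Heavy : Fin n → Fin n → Set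
  Heavy a b = 3 ≤ w a b

  edge-sym : ∀ {a b c} → T (edge H a b c) → T (edge H b a c)
  edge-sym {a} {b} {c} = subst T (symmetric H a b c)

  heavy-sym : ∀ {a b} → Heavy a b → Heavy b a
  heavy-sym {a} {b} = subst (3 ≤_) (sum-cong-≗ {n} λ c → cong ι (symmetric H a b c))

  -- Three heads cannot all lie in a set of two vertices.
  heavy-head : ∀ {a b} → Heavy a b → ∀ u v → ∃[ c ] T (edge H a b c) × c ≢ u × c ≢ v
  heavy-head {a} {b} 3≤w u v with any? (λ c → T? (edge H a b c) ×-dec ¬? (c ≟ u) ×-dec ¬? (c ≟ v))
  ... | yes found = found
  ... | no none = contradiction (≤-trans 3≤w (sum-supported₂ (edge H a b) u v only-uv)) λ { (s≤s (s≤s ())) }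
    where
    only-uv : ∀ c → T (edge H a b c) → c ≡ u ⊎ c ≡ v
    only-uv c abc with c ≟ u | c ≟ v
    ... | yes c≡u | _       = inj₁ c≡u
    ... | no  _   | yes c≡v = inj₂ c≡v
    ... | no  c≢u | no  c≢v = ⊥-elim (none (c , abc , c≢u , c≢v))

  heavy-irrefl : ∀ {a b} → Heavy a b → a ≢ b
  heavy-irrefl {a} {b} hab with heavy-head hab a a
  ... | c , abc , _ = proj₁ (distinct H a b c abc)

  -- For an arc `u→v` in the link of `a`, choose a head `c` of `{a,b}` outside `{u,v}`: the arcs
  -- `b→c` and `u→v` can then meet only in `b`.
  heavy-star : ∀ {a b} → Heavy a b → Star a b
  heavy-star hab {u} {v} auv with heavy-head hab u v
  ... | c , abc , c≢u , c≢v with meet auv abc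
  ...   | inj₁ u≡b               = inj₁ u≡b
  ...   | inj₂ (inj₁ u≡c)        = ⊥-elim (c≢u (sym u≡c))
  ...   | inj₂ (inj₂ (inj₁ v≡b)) = inj₂ v≡b
  ...   | inj₂ (inj₂ (inj₂ v≡c)) = ⊥-elim (c≢v (sym v≡c))

  -- This makes the heavy pairs a matching: an arc `b→c` with `c ≢ b′` touches the centre `b′` of
  -- the link of `a`, hence starts there.
  heavy-unique : ∀ {a b b′} → Heavy a b → Heavy a b′ → b ≡ b′
  heavy-unique {b′ = b′} hab hab′ with heavy-head hab b′ b′
  ... | c , abc , c≢b′ , _ = [ id , (λ c≡b′ → ⊥-elim (c≢b′ c≡b′)) ] (heavy-star hab′ abc)

  inDegree : Fin n → Fin n → ℕ
  inDegree a s = sum (λ b → ι (edge H a b s))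

  -- Arcs leaving `s` are counted by `w a s`; any other arc ends in `s`, so each other tail
  -- contributes at most one.
  star-degree : ∀ {a s} → Star a s → deg a ≤ w a s + inDegree a s
  star-degree {a} {s} star = begin
    deg a                                                  ≤⟨ sum-mono bound ⟩
    sum (λ b → δ s b * w a s + ι (edge H a b s))           ≡⟨ ∑-distrib-+ {n} _ _ ⟩
    sum (λ b → δ s b * w a s) + inDegree a s               ≡⟨ cong (_+ inDegree a s) (sum-δ-* s (λ _ → w a s)) ⟩
    w a s + inDegree a s                                   ∎
    where
    open ≤-Reasoning
    bound : ∀ b → w a b ≤ δ s b * w a s + ι (edge H a b s)
    bound b with s ≟ b
    ... | yes refl = ≤-trans (≤-reflexive (sym (+-identityʳ _))) (m≤m+n _ _)
    ... | no s≢b = sum-supported (edge H a b) s λ c abc → [ (λ b≡s → ⊥-elim (s≢b (sym b≡s))) , id ] (star abc)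

  2≤n : 2 ≤ n
  2≤n = ≤-trans (s≤s (s≤s z≤n)) 8≤n

  weight-bound : ∀ a b → w a b + 2 ≤ n
  weight-bound a b with a ≟ b
  ... | yes refl = ≤-trans (+-monoˡ-≤ 2 (sum-zero _ λ c → ι-≤ _ λ aac →
      ⊥-elim (proj₁ (distinct H a a c aac) refl))) 2≤n
  ... | no a≢b = sum-avoiding₂ (edge H a b) a≢b
    (λ aba → proj₁ (proj₂ (distinct H a b a aba)) refl) (λ abb → proj₂ (proj₂ (distinct H a b b abb)) refl)

  inDegree-bound : ∀ a s → inDegree a s + 2 ≤ n
  inDegree-bound a s with a ≟ s
  ... | yes refl = ≤-trans (+-monoˡ-≤ 2 (sum-zero _ λ b → ι-≤ _ λ aba →
      ⊥-elim (proj₁ (proj₂ (distinct H a b a aba)) refl))) 2≤n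
  ... | no a≢s = sum-avoiding₂ (λ b → edge H a b s) a≢s
    (λ aas → proj₁ (distinct H a a s aas) refl) (λ ass → proj₂ (proj₂ (distinct H a s s ass)) refl)

  -- Discharging: an edge `xa→y` with `{x,y}` heavy moves one unit from `x` to `a`.

  heavyEdge : Fin n → Fin n → Fin n → Bool
  heavyEdge x a y = (3 ≤ᵇ w x y) ∧ edge H x a y

  heavyEdge⁺ : ∀ {x a y} → Heavy x y → T (edge H x a y) → T (heavyEdge x a y)
  heavyEdge⁺ hxy xay = Equivalence.from T-∧ (≤⇒≤ᵇ hxy , xay)

  heavyEdge⁻ : ∀ {x a y} → T (heavyEdge x a y) → Heavy x y × T (edge H x a y)
  heavyEdge⁻ {x} {a} {y} h with Equivalence.to (T-∧ {3 ≤ᵇ w x y}) h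
  ... | hxy , xay = ≤ᵇ⇒≤ 3 _ hxy , xay

  given received : Fin n → ℕ
  given    x = sum (λ a → sum (λ y → ι (heavyEdge x a y)))
  received a = sum (λ x → sum (λ y → ι (heavyEdge x a y)))

  received≤0 : ∀ {a} → (∀ x y → ¬ T (heavyEdge x a y)) → received a ≤ 0
  received≤0 none = sum-zero _ λ x → sum-zero _ λ y → ι-≤ _ λ h → ⊥-elim (none x y h)

  -- The link of `a` is a star centred at `b`. Each arc into `b` is paid back by a unit given away,
  -- nothing is received, and at most `n − 2` arcs leave `b`. The 3 is the gap between `n − 2` and
  -- `n + 1`.
  heavy-bound : ∀ {a b} → Heavy a b → deg a + received a + 3 ≤ suc n + given a
  heavy-bound {a} {b} hab = begin
    deg a + received a + 3             ≤⟨ +-monoˡ-≤ 3 (+-mono-≤ (star-degree (heavy-star hab)) (received≤0 none)) ⟩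
    w a b + inDegree a b + 0 + 3       ≡⟨ rearrange (w a b) (inDegree a b) ⟩
    suc (w a b + 2) + inDegree a b     ≤⟨ +-mono-≤ (s≤s (weight-bound a b)) inDegree≤given ⟩
    suc n + given a                    ∎
    where
    open ≤-Reasoning
    rearrange : ∀ k l → k + l + 0 + 3 ≡ suc (k + 2) + l
    rearrange = solve-∀
    inDegree≤given : inDegree a b ≤ given a
    inDegree≤given = sum-mono λ c → ≤-trans
      (ι-≤ _ λ acb → 1≤ι (heavyEdge⁺ {a} {c} {b} hab acb))
      (term≤sum (λ y → ι (heavyEdge a c y)) b)
    -- The arc `x→y` in the link of `a` would touch `b`, whose only heavy partner is `a`; then `x`
    -- or `y` would equal `a`.
    none : ∀ x y → ¬ T (heavyEdge x a y)
    none x y h with heavyEdge⁻ {x} h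
    ... | hxy , xay with distinct H x a y xay | heavy-star hab (edge-sym xay)
    ...   | _ , _ , a≢y | inj₁ refl = a≢y (heavy-unique (heavy-sym hab) hxy)
    ...   | x≢a , _ , _ | inj₂ refl = x≢a (heavy-unique (heavy-sym hxy) (heavy-sym hab))

  -- Two heavy pairs that send charge to `a` span arcs in its link, so they share a vertex and
  -- coincide by the matching property. Only `xa→y` and `ya→x` can contribute.
  received≤2 : ∀ {x a y} → Heavy x y → T (edge H x a y) → received a ≤ 2
  received≤2 {x} {a} {y} hxy xay = begin
    received a
      ≤⟨ sum-mono (λ u → sum-mono λ v → ι-≤ _ λ h → bound u v h) ⟩
    sum (λ u → sum (λ v → δ x u * δ y v + δ y u * δ x v))
      ≡⟨ ∑∑-distrib-+ (λ u v → δ x u * δ y v) (λ u v → δ y u * δ x v) ⟩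
    sum (λ u → sum (λ v → δ x u * δ y v)) + sum (λ u → sum (λ v → δ y u * δ x v))
      ≡⟨ cong₂ _+_ (sum-δ-δ x y) (sum-δ-δ y x) ⟩
    2 ∎
    where
    open ≤-Reasoning
    same-pair : ∀ {u v} → Heavy u v → T (edge H u a v) → (x ≡ u × y ≡ v) ⊎ (y ≡ u × x ≡ v)
    same-pair huv uav with meet (edge-sym xay) (edge-sym uav)
    ... | inj₁ refl               = inj₁ (refl , heavy-unique hxy huv)
    ... | inj₂ (inj₁ refl)        = inj₂ (heavy-unique hxy (heavy-sym huv) , refl)
    ... | inj₂ (inj₂ (inj₁ refl)) = inj₂ (refl , heavy-unique (heavy-sym hxy) huv)
    ... | inj₂ (inj₂ (inj₂ refl)) = inj₁ (heavy-unique (heavy-sym hxy) (heavy-sym huv) , refl)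
    bound : ∀ u v → T (heavyEdge u a v) → 1 ≤ δ x u * δ y v + δ y u * δ x v
    bound u v h with heavyEdge⁻ {u} h
    ... | huv , uav with same-pair huv uav
    ...   | inj₁ (x≡u , y≡v) = ≤-trans (*-mono-≤ (1≤δ x≡u) (1≤δ y≡v)) (m≤m+n _ _)
    ...   | inj₂ (y≡u , x≡v) = ≤-trans (*-mono-≤ (1≤δ y≡u) (1≤δ x≡v)) (m≤n+m _ _)

  -- Vertices in no heavy pair.

  module Light (a : Fin n) (light : ∀ b → w a b ≤ 2) where

    triangle-degree : ∀ {p q r} → (∀ {b c} → T (edge H a b c) → b ≡ p ⊎ b ≡ q ⊎ b ≡ r) → deg a ≤ 6
    triangle-degree {p} {q} {r} tails = begin
      deg a                                          ≤⟨ sum-mono bound ⟩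
      sum (λ b → 2 * (δ p b + (δ q b + δ r b)))      ≡⟨ *-distribˡ-sum 2 (λ b → δ p b + (δ q b + δ r b)) ⟨
      2 * sum (λ b → δ p b + (δ q b + δ r b))        ≡⟨ cong (2 *_) (∑-distrib-+ (δ p) _) ⟩
      2 * (sum (δ p) + sum (λ b → δ q b + δ r b))    ≡⟨ cong (λ k → 2 * (sum (δ p) + k)) (∑-distrib-+ (δ q) (δ r)) ⟩
      2 * (sum (δ p) + (sum (δ q) + sum (δ r)))      ≡⟨ cong (2 *_) (cong₂ _+_ (sum-δ p) (cong₂ _+_ (sum-δ q) (sum-δ r))) ⟩
      6                                              ∎
      where
      open ≤-Reasoning
      bound : ∀ b → w a b ≤ 2 * (δ p b + (δ q b + δ r b))
      bound b with p ≟ b | q ≟ b | r ≟ b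
      ... | yes _  | _      | _      = ≤-trans (light b) (*-monoʳ-≤ 2 (s≤s z≤n))
      ... | no _   | yes _  | _      = ≤-trans (light b) (*-monoʳ-≤ 2 (s≤s z≤n))
      ... | no _   | no _   | yes _  = light b
      ... | no p≢b | no q≢b | no r≢b = sum-zero _ λ c → ι-≤ _ λ abc →
        ⊥-elim ([ p≢b ∘ sym , [ q≢b ∘ sym , r≢b ∘ sym ] ] (tails {b} {c} abc))

    -- The underlying undirected graph of the link, to which `star-or-triangle` applies.
    Linked : Fin n → Fin n → Set
    Linked b c = T (edge H a b c) ⊎ T (edge H a c b)

    linked-irrefl : ∀ {b c} → Linked b c → b ≢ c
    linked-irrefl {b} {c} (inj₁ abc) = proj₂ (proj₂ (distinct H a b c abc))
    linked-irrefl {b} {c} (inj₂ acb) = ≢-sym (proj₂ (proj₂ (distinct H a c b acb)))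

    edge-meet-linked : ∀ {b c d e} → T (edge H a b c) → Linked d e → b ≡ d ⊎ b ≡ e ⊎ c ≡ d ⊎ c ≡ e
    edge-meet-linked abc (inj₁ ade) = meet abc ade
    edge-meet-linked abc (inj₂ aed) with meet abc aed
    ... | inj₁ b≡e               = inj₂ (inj₁ b≡e)
    ... | inj₂ (inj₁ b≡d)        = inj₁ b≡d
    ... | inj₂ (inj₂ (inj₁ c≡e)) = inj₂ (inj₂ (inj₂ c≡e))
    ... | inj₂ (inj₂ (inj₂ c≡d)) = inj₂ (inj₂ (inj₁ c≡d))

    linked-meet : ∀ {b c d e} → Linked b c → Linked d e → b ≡ d ⊎ b ≡ e ⊎ c ≡ d ⊎ c ≡ e
    linked-meet (inj₁ abc) linked = edge-meet-linked abc linked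
    linked-meet (inj₂ acb) linked with edge-meet-linked acb linked
    ... | inj₁ c≡d               = inj₂ (inj₂ (inj₁ c≡d))
    ... | inj₂ (inj₁ c≡e)        = inj₂ (inj₂ (inj₂ c≡e))
    ... | inj₂ (inj₂ (inj₁ b≡d)) = inj₁ b≡d
    ... | inj₂ (inj₂ (inj₂ b≡e)) = inj₂ (inj₁ b≡e)

    star-or-small : ∃ (Star a) ⊎ deg a ≤ 6
    star-or-small with star-or-triangle (λ b c → T? (edge H a b c) ⊎-dec T? (edge H a c b))
                                        -- The vertex `a` is on no arc of its own link, so it is
                                        -- returned as centre only when the link is empty.
                                        swap linked-irrefl linked-meet a
    ... | inj₁ (s , star)          = inj₁ (s , star ∘ inj₁)
    ... | inj₂ (p , q , r , tails) = inj₂ (triangle-degree (tails ∘ inj₁))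

    -- In a star, at most 2 arcs leave the centre and at most `n − 2` enter it; otherwise the size
    -- is at most 6.
    degree≤n : deg a ≤ n
    degree≤n with star-or-small
    ... | inj₂ deg≤6 = ≤-trans deg≤6 (≤-trans (m≤m+n 6 2) 8≤n)
    ... | inj₁ (s , star) = begin
      deg a                ≤⟨ star-degree star ⟩
      w a s + inDegree a s ≤⟨ +-monoˡ-≤ _ (light s) ⟩
      2 + inDegree a s     ≡⟨ +-comm 2 _ ⟩
      inDegree a s + 2     ≤⟨ inDegree-bound a s ⟩
      n                    ∎
      where open ≤-Reasoning

    -- The arc `x→y` lies in the link of `a`, so the centre of a star link is `x` or `y`. Being in a
    -- heavy pair, it sends out at most one arc instead of two.
    degree<n : ∀ {x y} → Heavy x y → T (edge H x a y) → suc (deg a) ≤ n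
    degree<n {x} {y} hxy xay with star-or-small
    ... | inj₂ deg≤6 = ≤-trans (s≤s deg≤6) (≤-trans (m≤m+n 7 1) 8≤n)
    ... | inj₁ (s , star) with distinct H x a y xay
    ...   | x≢a , _ , a≢y =
      [ (λ { refl → centred hxy a≢y })
      , (λ { refl → centred (heavy-sym hxy) (≢-sym x≢a) }) ] (star (edge-sym xay))
      where
      open ≤-Reasoning
      centred : ∀ {z} → Heavy s z → a ≢ z → suc (deg a) ≤ n
      centred {z} hsz a≢z = begin
        suc (deg a)                ≤⟨ s≤s (star-degree star) ⟩
        suc (w a s + inDegree a s) ≤⟨ s≤s (+-monoˡ-≤ _ weight≤1) ⟩
        2 + inDegree a s           ≡⟨ +-comm 2 _ ⟩
        inDegree a s + 2           ≤⟨ inDegree-bound a s ⟩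
        n                          ∎
        where
        -- The link of `s` is a star centred at `z`, and `a→c` is one of its arcs with `a ≢ z`.
        only-z : ∀ c → T (edge H a s c) → c ≡ z
        only-z c asc = [ (λ a≡z → ⊥-elim (a≢z a≡z)) , id ] (heavy-star hsz (edge-sym asc))
        weight≤1 : w a s ≤ 1
        weight≤1 = ≤-trans (sum-supported (edge H a s) z only-z) (ι-≤ _ λ _ → ≤-refl)

    -- Receiving charge, at most 2, forces the link size down to `n − 1`; otherwise the size is at
    -- most `n`.
    light-bound : deg a + received a ≤ suc n
    light-bound with any? (λ x → any? λ y → T? (heavyEdge x a y))
    ... | no none = ≤-trans (+-mono-≤ degree≤n (received≤0 λ x y h → none (x , y , h)))
                            (≤-trans (≤-reflexive (+-identityʳ n)) (n≤1+n n))
    ... | yes (x , y , h) with heavyEdge⁻ {x} h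
    ...   | hxy , xay = begin
      deg a + received a ≤⟨ +-monoʳ-≤ (deg a) (received≤2 hxy xay) ⟩
      deg a + 2          ≡⟨ +-comm (deg a) 2 ⟩
      2 + deg a          ≤⟨ s≤s (degree<n hxy xay) ⟩
      suc n              ∎
      where open ≤-Reasoning

  -- Summing the charges.

  heavy? : ∀ a b → Dec (Heavy a b)
  heavy? a b = 3 ≤? w a b

  vertex-bound : ∀ a → deg a + received a ≤ suc n + given a
  vertex-bound a with any? (heavy? a)
  ... | yes (b , hab) = ≤-trans (m≤m+n _ 3) (heavy-bound hab)
  ... | no none = ≤-trans (Light.light-bound a λ b → ≤-pred (≰⇒> (λ hab → none (b , hab)))) (m≤m+n _ _)

  sum-degree-bound : sum deg + 6 ≤ suc n * n
  sum-degree-bound with any? (λ p → any? (heavy? p))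
  ... | no none = begin
    -- Without heavy pairs the slack `n ≥ 8` already covers the 6.
    sum deg + 6 ≤⟨ +-mono-≤ (sum-bounded deg n λ a → Light.degree≤n a λ b → ≤-pred (≰⇒> (λ hab → none (a , b , hab))))
                            (≤-trans (m≤m+n 6 2) 8≤n) ⟩
    n * n + n   ≡⟨ +-comm (n * n) n ⟩
    suc n * n   ∎
    where open ≤-Reasoning
  ... | yes (p , q , hpq) = +-cancelʳ-≤ (sum given) _ _ (begin
    sum deg + 6 + sum given
      -- The 6 is split as 3 at `p` and 3 at `q`, and the total given is exchanged for the total
      -- received.
      ≡⟨ cong₂ (λ k l → sum deg + 3 * k + l) (cong₂ _+_ (sum-δ p) (sum-δ q))
           (∑-comm λ a x → sum (λ y → ι (heavyEdge x a y))) ⟨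
    sum deg + 3 * (sum (δ p) + sum (δ q)) + sum received
      ≡⟨ rearrange (sum deg) _ (sum received) ⟩
    sum deg + sum received + 3 * (sum (δ p) + sum (δ q))
      ≡⟨ cong₂ _+_ (∑-distrib-+ deg received)
           (trans (sym (*-distribˡ-sum 3 (λ a → δ p a + δ q a))) (cong (3 *_) (∑-distrib-+ (δ p) (δ q)))) ⟨
    sum (λ a → deg a + received a) + sum (λ a → 3 * (δ p a + δ q a))
      ≡⟨ ∑-distrib-+ {n} _ _ ⟨
    sum (λ a → deg a + received a + 3 * (δ p a + δ q a))
      ≤⟨ sum-mono bound ⟩
    sum (λ a → suc n + given a)
      ≡⟨ ∑-distrib-+ {n} (λ _ → suc n) given ⟩
    sum {n} (λ _ → suc n) + sum given
      ≡⟨ cong (_+ sum given) (trans (sum-const n (suc n)) (*-comm n (suc n))) ⟩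
    suc n * n + sum given ∎)
    where
    open ≤-Reasoning
    rearrange : ∀ k l m → k + l + m ≡ k + m + l
    rearrange = solve-∀
    bound : ∀ a → deg a + received a + 3 * (δ p a + δ q a) ≤ suc n + given a
    bound a with p ≟ a | q ≟ a
    -- A coincidence of `p` and `q` would demand a slack of 6 at a single vertex.
    ... | yes refl | yes refl = ⊥-elim (heavy-irrefl hpq refl)
    ... | yes refl | no _     = heavy-bound hpq
    ... | no _     | yes refl = heavy-bound (heavy-sym hpq)
    ... | no _     | no _     = ≤-trans (≤-reflexive (+-identityʳ _)) (vertex-bound a)

-- The extremal graph on `2 + m` vertices.

module Extremal (m : ℕ) where

  -- The split by head and the literal patterns let the link sizes below unfold by computation.
  into0 into1 into2+ : Fin (2 + m) → Fin (2 + m) → Bool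
  into0 0F      _       = false
  into0 (suc _) 0F      = false
  into0 (suc a) (suc b) = not (does (a ≟ b))

  into1 0F            (suc (suc _)) = true
  into1 (suc (suc _)) 0F            = true
  into1 _             _             = false

  into2+ 0F 1F = true
  into2+ 1F 0F = true
  into2+ _  _  = false

  adj : Fin (2 + m) → Fin (2 + m) → Fin (2 + m) → Bool
  adj a b 0F            = into0 a b
  adj a b 1F            = into1 a b
  adj a b (suc (suc _)) = into2+ a b

  adj-sym : ∀ a b c → adj a b c ≡ adj b a c
  adj-sym 0F      0F      0F = refl
  adj-sym 0F      (suc _) 0F = refl
  adj-sym (suc _) 0F      0F = refl
  adj-sym (suc a) (suc b) 0F with a ≟ b | b ≟ a
  ... | yes _    | yes _   = refl
  ... | no _     | no _    = refl
  ... | yes refl | no a≢a  = ⊥-elim (a≢a refl)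
  ... | no a≢a   | yes refl = ⊥-elim (a≢a refl)
  adj-sym 0F            0F            1F = refl
  adj-sym 0F            1F            1F = refl
  adj-sym 0F            (suc (suc _)) 1F = refl
  adj-sym 1F            0F            1F = refl
  adj-sym 1F            1F            1F = refl
  adj-sym 1F            (suc (suc _)) 1F = refl
  adj-sym (suc (suc _)) 0F            1F = refl
  adj-sym (suc (suc _)) 1F            1F = refl
  adj-sym (suc (suc _)) (suc (suc _)) 1F = refl
  adj-sym 0F            0F            (suc (suc _)) = refl
  adj-sym 0F            1F            (suc (suc _)) = refl
  adj-sym 0F            (suc (suc _)) (suc (suc _)) = refl
  adj-sym 1F            0F            (suc (suc _)) = refl
  adj-sym 1F            1F            (suc (suc _)) = refl
  adj-sym 1F            (suc (suc _)) (suc (suc _)) = refl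
  adj-sym (suc (suc _)) 0F            (suc (suc _)) = refl
  adj-sym (suc (suc _)) 1F            (suc (suc _)) = refl
  adj-sym (suc (suc _)) (suc (suc _)) (suc (suc _)) = refl

  adj-distinct : ∀ a b c → T (adj a b c) → a ≢ b × a ≢ c × b ≢ c
  adj-distinct (suc a) (suc b) 0F h with a ≟ b
  ... | no a≢b = (λ { refl → a≢b refl }) , (λ ()) , (λ ())
  adj-distinct 0F            (suc (suc _)) 1F            _ = (λ ()) , (λ ()) , (λ ())
  adj-distinct (suc (suc _)) 0F            1F            _ = (λ ()) , (λ ()) , (λ ())
  adj-distinct 0F            1F            (suc (suc _)) _ = (λ ()) , (λ ()) , (λ ())
  adj-distinct 1F            0F            (suc (suc _)) _ = (λ ()) , (λ ()) , (λ ())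

  adj-distinct 1F            (suc _)       1F            ()
  adj-distinct (suc (suc _)) (suc _)       1F            ()
  adj-distinct 1F            (suc _)       (suc (suc _)) ()
  adj-distinct (suc (suc _)) _             (suc (suc _)) ()

  graph : Graph (2 + m)
  graph = record { edge = adj ; symmetric = adj-sym ; distinct = adj-distinct }

  centre : Fin (2 + m) → Fin (2 + m)
  centre 0F      = 1F
  centre (suc _) = 0F

  adj-star : ∀ x a b → T (adj x a b) → a ≡ centre x ⊎ b ≡ centre x
  adj-star (suc _)       _             0F            _ = inj₂ refl
  adj-star 0F            _             1F            _ = inj₂ refl
  adj-star (suc (suc _)) 0F            1F            _ = inj₁ refl
  adj-star 0F            1F            (suc (suc _)) _ = inj₁ refl
  adj-star 1F            0F            (suc (suc _)) _ = inj₁ refl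

  -- A copy of `H₁` would give two disjoint arcs in the link of `φ 4F`, both through its centre.
  graph-free : graph IsFreeOf H₁
  graph-free (φ , φ-inj , embeds)
    with adj-star (φ 4F) (φ 0F) (φ 1F) (embeds 4F 0F 1F tt) | adj-star (φ 4F) (φ 2F) (φ 3F) (embeds 4F 2F 3F tt)
  ... | inj₁ p | inj₁ q = contradiction (φ-inj (trans p (sym q))) λ ()
  ... | inj₁ p | inj₂ q = contradiction (φ-inj (trans p (sym q))) λ ()
  ... | inj₂ p | inj₁ q = contradiction (φ-inj (trans p (sym q))) λ ()
  ... | inj₂ p | inj₂ q = contradiction (φ-inj (trans p (sym q))) λ ()

  private
    -- The contribution of the `m` vertices other than 0 and 1, left as a sum so as to match what
    -- `linkDegree` unfolds to.
    S : ℕ → ℕ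
    S k = sum {m} (λ _ → k)

    S0≡0 : S 0 ≡ 0
    S0≡0 = trans (sum-const m 0) (*-zeroʳ m)

    S1≡m : S 1 ≡ m
    S1≡m = trans (sum-const m 1) (*-identityʳ m)

  degree-0 : linkDegree graph 0F ≡ m + m
  degree-0 = begin
    S 0 + (S 1 + S (1 + S 0)) ≡⟨ cong (λ z → z + (S 1 + S (1 + z))) S0≡0 ⟩
    S 1 + S 1                 ≡⟨ cong₂ _+_ S1≡m S1≡m ⟩
    m + m                     ∎
    where open ≡-Reasoning

  degree-1 : linkDegree graph 1F ≡ m + m
  degree-1 = begin
    S 1 + (S 0 + S (1 + S 0)) ≡⟨ cong (λ z → S 1 + (z + S (1 + z))) S0≡0 ⟩
    S 1 + S 1                 ≡⟨ cong₂ _+_ S1≡m S1≡m ⟩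
    m + m                     ∎
    where open ≡-Reasoning

  -- The arcs are `0→1`, `1→0` and `b→0` for the `m − 1` remaining vertices `b`.
  degree-2+ : ∀ a → linkDegree graph (suc (suc a)) ≡ 1 + m
  degree-2+ a = begin
    (1 + S 0) + ((1 + S 0) + sum (λ b → ι≢ b + S 0)) ≡⟨ cong (λ z → (1 + z) + ((1 + z) + sum (λ b → ι≢ b + z))) S0≡0 ⟩
    2 + sum (λ b → ι≢ b + 0)                         ≡⟨ cong (2 +_) (sum-cong-≗ λ b → +-identityʳ (ι≢ b)) ⟩
    1 + (1 + sum ι≢)                                 ≡⟨ cong (λ k → 1 + (k + sum ι≢)) (sum-δ a) ⟨
    1 + (sum (δ a) + sum ι≢)                         ≡⟨ cong suc (∑-distrib-+ (δ a) ι≢) ⟨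
    1 + sum (λ b → δ a b + ι≢ b)                     ≡⟨ cong suc (sum-cong-≗ λ b → ι+ι-not (does (a ≟ b))) ⟩
    1 + S 1                                          ≡⟨ cong suc S1≡m ⟩
    1 + m                                            ∎
    where
    open ≡-Reasoning
    ι≢ : Fin m → ℕ
    ι≢ b = ι (not (does (a ≟ b)))
    ι+ι-not : ∀ b → ι b + ι (not b) ≡ 1
    ι+ι-not true  = refl
    ι+ι-not false = refl

  sum-degree : sum (linkDegree graph) + 6 ≡ suc (2 + m) * (2 + m)
  sum-degree = begin
    linkDegree graph 0F + (linkDegree graph 1F + sum (λ a → linkDegree graph (suc (suc a)))) + 6
      ≡⟨ cong (_+ 6) (cong₂ _+_ degree-0 (cong₂ _+_ degree-1
           (trans (sum-cong-≗ degree-2+) (sum-const m (1 + m))))) ⟩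
    m + m + (m + m + m * (1 + m)) + 6
      ≡⟨ expand m ⟩
    suc (2 + m) * (2 + m) ∎
    where
    open ≡-Reasoning
    expand : ∀ m → m + m + (m + m + m * (1 + m)) + 6 ≡ suc (2 + m) * (2 + m)
    expand = solve-∀

-- Both bounds, from link sizes back to edge counts.

theorem4p2 : ∀ (n : ℕ) → 8 ≤ n → ex[ n , H₁ ]≡ (suc n C 2 ∸ 3)
theorem4p2 1 (s≤s ())
theorem4p2 n@(suc (suc m)) 8≤n =
  (graph , graph-free , attained) , λ H free → m+n≤o⇒m≤o∸n (edgeCount H) (bounded H free)
  where
  open Extremal m
  open ≤-Reasoning
  -- Adding 3 and doubling avoids division and truncated subtraction until the last step.
  double : ∀ (H : Graph n) → 2 * (edgeCount H + 3) ≡ sum (linkDegree H) + 6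
  double H = trans (*-distribˡ-+ 2 (edgeCount H) 3) (cong (_+ 6) (2*edgeCount H))
  attained : edgeCount graph ≡ suc n C 2 ∸ 3
  attained = trans (sym (m+n∸n≡m (edgeCount graph) 3))
    (cong (_∸ 3) (*-cancelˡ-≡ (edgeCount graph + 3) (suc n C 2) 2
      (trans (double graph) (trans sum-degree (sym (2*[1+n]C2 n))))))
  bounded : ∀ H → H IsFreeOf H₁ → edgeCount H + 3 ≤ suc n C 2
  bounded H free = *-cancelˡ-≤ {edgeCount H + 3} {suc n C 2} 2 (begin
    2 * (edgeCount H + 3)      ≡⟨ double H ⟩
    sum (linkDegree H) + 6     ≤⟨ UpperBound.sum-degree-bound H 8≤n (free⇒intersecting H free) ⟩
    suc n * n                  ≡⟨ 2*[1+n]C2 n ⟨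
    2 * (suc n C 2)            ∎)
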